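{- Let $k\ge1$, $t\ge 0$ and $n\ge kt$ be integers. Then $S(n,t,k)=k^t$. Moreover, if $F$ is a $t$-admissible $k$-CNF formula on $n$ variables with $|\mathrm{sat}_t(F)|=k^t$, then $F$ contains $t$ pairwise variable-disjoint clauses each of the form $(x_{i_1}\lor\dots\lor x_{i_k})$, i.e. consisting of $k$ distinct un-negated variables.
   Context: A $k$-CNF formula is a conjunction of clauses (disjunctions of literals) each of width at most $k$. $\mathrm{sat}_t(F)$ is the set of satisfying assignments of $F$ of Hamming weight exactly $t$. $F$ is $t$-admissible if it has no satisfying assignment of Hamming weight less than $t$. $S(n,t,k)$ is the maximum of $|\mathrm{sat}_t(F)|$ over all $t$-admissible $k$-CNF formulas $F$ on $n$ variables. -}

module Defs where

open import Data.Bool using (Bool; true; false)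
import Data.Bool.Properties as Bool
open import Data.Fin using (Fin)
open import Data.Fin.Subset using (∣_∣)
open import Data.List using (List; []; _∷_; _++_; map; filter; length; tabulate)
open import Data.List.Relation.Binary.Disjoint.Propositional using (Disjoint)
open import Data.List.Relation.Unary.All using (All; all?)
open import Data.List.Relation.Unary.Any using (Any; any?)
open import Data.Nat using (ℕ; zero; suc; _≤_; _<_; _≟_)
open import Data.Product using (∃-syntax; _×_)
open import Data.Vec using (Vec; []; _∷_; lookup)
open import Function using (_∘_)
open import Function.Definitions using (Injective)
open import Level using (Level)
open import Relation.Binary.PropositionalEquality using (_≡_)
open import Relation.Nullary using (¬_; _×-dec_)
open import Relation.Unary using (Pred; Decidable)

private
  variable
    ℓ : Level
    n : ℕ

data Literal (n : ℕ) : Set where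
  pos neg : Fin n → Literal n

var : Literal n → Fin n
var (pos i) = i
var (neg i) = i

-- Repeated and complementary literals are permitted, so every set of
-- literals is represented, at a width equal to its size.
Clause : ℕ → Set
Clause n = List (Literal n)

width : Clause n → ℕ
width = length

vars : Clause n → List (Fin n)
vars = map var

CNF : ℕ → Set
CNF n = List (Clause n)

IsKCNF : ℕ → CNF n → Set
IsKCNF k F = All (λ C → width C ≤ k) F

Assignment : ℕ → Set
Assignment n = Vec Bool n

-- An assignment is literally a Data.Fin.Subset, so ∣_∣ counts its true entries.
weight : Assignment n → ℕ
weight α = ∣ α ∣

infix 4 _⊨ˡ_ _⊨ᶜ_ _⊨_ _⊨ˡ?_ _⊨ᶜ?_ _⊨?_

_⊨ˡ_ : Assignment n → Literal n → Set
α ⊨ˡ pos i = lookup α i ≡ true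
α ⊨ˡ neg i = lookup α i ≡ false

_⊨ᶜ_ : Assignment n → Clause n → Set
α ⊨ᶜ C = Any (α ⊨ˡ_) C

_⊨_ : Assignment n → CNF n → Set
α ⊨ F = All (α ⊨ᶜ_) F

_⊨ˡ?_ : (α : Assignment n) → Decidable (α ⊨ˡ_)
α ⊨ˡ? pos i = lookup α i Bool.≟ true
α ⊨ˡ? neg i = lookup α i Bool.≟ false

_⊨ᶜ?_ : (α : Assignment n) → Decidable (α ⊨ᶜ_)
α ⊨ᶜ? C = any? (α ⊨ˡ?_) C

_⊨?_ : (α : Assignment n) → Decidable (α ⊨_)
α ⊨? F = all? (α ⊨ᶜ?_) F

-- Each assignment is listed exactly once, so lengths of filtered sublists
-- are cardinalities.
assignments : ∀ n → List (Assignment n)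
assignments zero    = [] ∷ []
assignments (suc n) = map (false ∷_) (assignments n) ++ map (true ∷_) (assignments n)

sat : ℕ → CNF n → List (Assignment n)
sat {n} t F = filter (λ α → (α ⊨? F) ×-dec (weight α ≟ t)) (assignments n)

∣sat∣ : ℕ → CNF n → ℕ
∣sat∣ t F = length (sat t F)

Admissible : ℕ → CNF n → Set
Admissible t F = ¬ (∃[ α ] α ⊨ F × weight α < t)

IsMaximum : Pred ℕ ℓ → Pred ℕ ℓ
IsMaximum P m = P m × (∀ x → P x → x ≤ m)

-- S[ n , t , k ]≡ m expresses S(n,t,k) = m; a maximum is unique when it exists.
S[_,_,_]≡_ : ℕ → ℕ → ℕ → ℕ → Set
S[ n , t , k ]≡ m =
  IsMaximum (λ x → ∃[ F ] IsKCNF {n} k F × Admissible t F × ∣sat∣ t F ≡ x) m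

-- C is x_{i₁} ∨ … ∨ x_{iₖ} with i₁, …, iₖ distinct.
IsPositiveClause : ℕ → Clause n → Set
IsPositiveClause {n} k C =
  ∃[ i ] Injective {A = Fin k} {B = Fin n} _≡_ _≡_ i × C ≡ tabulate (pos ∘ i)

VariableDisjoint : Clause n → Clause n → Set
VariableDisjoint C D = Disjoint (vars C) (vars D)

{-# OPTIONS --safe #-}
-- Branching: an assignment A of weight below t falsifies some clause of F, and
-- every solution above A makes true one of the at most k variables outside A
-- that occur positively there. Adding such a variable to A and recursing t
-- times bounds the number of solutions by k ^ t. If the bound is attained,
-- every branching clause consists of k variables and the branches are
-- disjoint, so no solution makes two literals of a branching clause true;
-- since each variable of a clause found along a branch is true in some
-- solution of that branch, it cannot occur in the earlier branching clauses.
module Submission where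

open import Algebra.Properties.CommutativeSemigroup using (x∙yz≈y∙xz)
open import Defs
open import Data.Bool using (true; false)
open import Data.Fin using (Fin; zero; suc; combine; inject≤; finToFun; funToFin)
open import Data.Fin.Properties
  using (0≢1+n; suc-injective; injective⇒≤; inject≤-injective; combine-injective;
         funToFin-finToFin)
open import Data.Fin.Subset using (Subset; ∣_∣; _∪_; ⋃; ⁅_⁆; ⊥; _⊆_; inside; outside)
  renaming (_∈_ to _∈ˢ_; _∉_ to _∉ˢ_)
open import Data.Fin.Subset.Properties
  using (⊆-antisym; ⊥⊆; ∉⊥; ∣⊥∣≡0; ∣⁅x⁆∣≡1; x∈⁅x⁆; x∈⁅y⁆⇒x≡y; p⊆p∪q; q⊆p∪q; x∈p∪q⁻;
         p⊂q⇒∣p∣<∣q∣; x∈p∧x≢y⇒x∈p-y; x∈p⇒∣p-x∣<∣p∣)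
  renaming (_∈?_ to _∈ˢ?_)
open import Data.List using (List; []; _∷_; map; filter; length; tabulate; lookup)
open import Data.List.Membership.Propositional using (_∈_; find; lose)
open import Data.List.Membership.Propositional.Properties
  using (∈-map⁺; ∈-map⁻; ∈-++⁺ˡ; ∈-++⁺ʳ; ∈-filter⁺; ∈-filter⁻; ∈-lookup)
open import Data.List.Properties
  using (filter-none; filter-some; length-tabulate; tabulate-cong; tabulate-lookup)
import Data.List.Relation.Unary.All as All
open import Data.List.Relation.Unary.All using ([]; _∷_)
import Data.List.Relation.Unary.All.Properties as All
import Data.List.Relation.Unary.Any as Any
open import Data.List.Relation.Unary.Any using (here; there)
import Data.List.Relation.Unary.Any.Properties as Any
open import Data.List.Relation.Unary.AllPairs using ([]; _∷_)
open import Data.List.Relation.Unary.Unique.Propositional using (Unique)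
import Data.List.Relation.Unary.Unique.Propositional.Properties as Unique
open import Data.Nat
  using (ℕ; zero; suc; _+_; _*_; _^_; _≤_; _<_; _≥_; z≤n; s≤s; NonZero;
         >-nonZero; >-nonZero⁻¹; _≟_)
open import Data.Nat.ListAction using (sum)
open import Data.Nat.Properties hiding (_≟_; 0≢1+n; suc-injective)
open import Data.Product using (Σ-syntax; ∃-syntax; _×_; _,_; proj₁; proj₂)
open import Data.Sum using (_⊎_; inj₁; inj₂)
import Data.Vec as Vec
import Data.Vec.Properties as Vec
open import Function using (_∘_)
open import Function.Definitions using (Injective)
open import Level using (Level)
open import Relation.Binary.PropositionalEquality
  using (_≡_; _≢_; refl; sym; trans; cong; cong₂; subst)
open import Relation.Nullary using (¬_; yes; no; _because_; contradiction; _×-dec_)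
open import Relation.Unary using (Pred; Decidable)

private
  variable
    a b p : Level
    A : Set a
    B : Set b
    n : ℕ

-- Finite sums and double counting

module _ (R : A → B → Set p) (R? : ∀ x → Decidable (R x)) where

  row : List B → A → ℕ
  row ys x = length (filter (R? x) ys)

  column : List A → B → ℕ
  column xs y = length (filter (λ x → R? x y) xs)

  sum-row-∷ : ∀ y ys xs → sum (map (row (y ∷ ys)) xs) ≡ column xs y + sum (map (row ys) xs)
  sum-row-∷ y ys [] = refl
  sum-row-∷ y ys (x ∷ xs) with ih ← sum-row-∷ y ys xs | R? x y
  ... | false because _ = trans (cong (row ys x +_) ih)
    (x∙yz≈y∙xz +-commutativeSemigroup (row ys x) (column xs y) (sum (map (row ys) xs)))
  ... | true  because _ = cong suc (trans (cong (row ys x +_) ih)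
    (x∙yz≈y∙xz +-commutativeSemigroup (row ys x) (column xs y) (sum (map (row ys) xs))))

  -- Both sides count the related pairs; the induction splits off one column at a time.
  double-counting : ∀ xs ys → sum (map (row ys) xs) ≡ sum (map (column xs) ys)
  double-counting xs []       = sum-zero xs
    where
    sum-zero : ∀ xs → sum (map (λ (_ : A) → 0) xs) ≡ 0
    sum-zero []       = refl
    sum-zero (_ ∷ xs) = sum-zero xs
  double-counting xs (y ∷ ys) = trans (sum-row-∷ y ys xs) (cong (column xs y +_) (double-counting xs ys))

module _ (f : A → ℕ) (b : ℕ) where

  sum≤length*b : ∀ xs → (∀ {x} → x ∈ xs → f x ≤ b) → sum (map f xs) ≤ length xs * b
  sum≤length*b []       f≤b = z≤n
  sum≤length*b (x ∷ xs) f≤b = +-mono-≤ (f≤b (here refl)) (sum≤length*b xs (f≤b ∘ there))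

  length*b≤sum : ∀ xs → (∀ {x} → x ∈ xs → b ≤ f x) → length xs * b ≤ sum (map f xs)
  length*b≤sum []       b≤f = z≤n
  length*b≤sum (x ∷ xs) b≤f = +-mono-≤ (b≤f (here refl)) (length*b≤sum xs (b≤f ∘ there))

  -- A single entry below `b` could not be made up for by the others, each of which is at most `b`.
  sum-tight-≤ : ∀ xs → (∀ {x} → x ∈ xs → f x ≤ b) → length xs * b ≤ sum (map f xs) →
                ∀ {x} → x ∈ xs → f x ≡ b
  sum-tight-≤ (x ∷ xs) f≤b len≤ = λ where
      (here refl)  → ≤-antisym (f≤b (here refl))
        (+-cancelʳ-≤ (length xs * b) b (f x)
          (≤-trans len≤ (+-monoʳ-≤ (f x) (sum≤length*b xs (f≤b ∘ there)))))
      (there x∈xs) → sum-tight-≤ xs (f≤b ∘ there)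
        (+-cancelˡ-≤ b _ _ (≤-trans len≤ (+-monoˡ-≤ _ (f≤b (here refl))))) x∈xs

  sum-tight-≥ : ∀ xs → (∀ {x} → x ∈ xs → b ≤ f x) → sum (map f xs) ≤ length xs * b →
                ∀ {x} → x ∈ xs → f x ≡ b
  sum-tight-≥ (x ∷ xs) b≤f ≤len = λ where
      (here refl)  → ≤-antisym
        (+-cancelʳ-≤ (length xs * b) (f x) b
          (≤-trans (+-monoʳ-≤ (f x) (length*b≤sum xs (b≤f ∘ there))) ≤len))
        (b≤f (here refl))
      (there x∈xs) → sum-tight-≥ xs (b≤f ∘ there)
        (+-cancelˡ-≤ b _ _ (≤-trans (+-monoˡ-≤ _ (b≤f (here refl))) ≤len)) x∈xs

module _ {P : Pred A p} (P? : Decidable P) where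

  -- Phrased with positions instead of values, so that a literal repeated in a clause counts twice.
  -- Distinctness of the variables of a clause rests on this.
  filter≤1⇒lookup-injective : ∀ xs → length (filter P? xs) ≤ 1 →
    ∀ i j → P (lookup xs i) → P (lookup xs j) → i ≡ j
  filter≤1⇒lookup-injective (x ∷ xs) ≤1 i j Pi Pj with P? x
  filter≤1⇒lookup-injective (x ∷ xs) ≤1 zero zero Pi Pj | _ = refl
  filter≤1⇒lookup-injective (x ∷ xs) (s≤s ≤0) zero (suc j) Pi Pj | yes _ =
    contradiction (filter-some P? (lose (∈-lookup {xs = xs} j) Pj)) (≤⇒≯ ≤0)
  filter≤1⇒lookup-injective (x ∷ xs) (s≤s ≤0) (suc i) j Pi Pj | yes _ =
    contradiction (filter-some P? (lose (∈-lookup {xs = xs} i) Pi)) (≤⇒≯ ≤0)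
  filter≤1⇒lookup-injective (x ∷ xs) ≤1 zero (suc j) Pi Pj | no ¬Px = contradiction Pi ¬Px
  filter≤1⇒lookup-injective (x ∷ xs) ≤1 (suc i) zero Pi Pj | no ¬Px = contradiction Pj ¬Px
  filter≤1⇒lookup-injective (x ∷ xs) ≤1 (suc i) (suc j) Pi Pj | no _ =
    cong suc (filter≤1⇒lookup-injective xs ≤1 i j Pi Pj)

length>0⇒∃∈ : (xs : List A) → 0 < length xs → ∃[ x ] x ∈ xs
length>0⇒∃∈ (x ∷ _) _ = x , here refl

unique∧constant⇒length≤1 : ∀ {x : A} {xs} → Unique xs → (∀ {y} → y ∈ xs → y ≡ x) → length xs ≤ 1
unique∧constant⇒length≤1 []                    _  = z≤n
unique∧constant⇒length≤1 (_ ∷ [])              _  = s≤s z≤n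
unique∧constant⇒length≤1 ((y≢z ∷ _) ∷ (_ ∷ _)) ≡x =
  contradiction (trans (≡x (here refl)) (sym (≡x (there (here refl))))) y≢z

-- Send `i` to the position of `f i` in `xs`: equal positions hold equal entries.
injective⇒≤length : ∀ {m} {f : Fin m → A} {xs} → Injective _≡_ _≡_ f → (∀ i → f i ∈ xs) → m ≤ length xs
injective⇒≤length {f = f} {xs} inj f∈xs = injective⇒≤ {f = Any.index ∘ f∈xs} λ {i} {j} eq →
  inj (trans (Any.lookup-index (f∈xs i))
      (trans (cong (lookup xs) eq) (sym (Any.lookup-index (f∈xs j)))))

-- Cardinalities of subsets

∣p∪q∣≤∣p∣+∣q∣ : (p q : Subset n) → ∣ p ∪ q ∣ ≤ ∣ p ∣ + ∣ q ∣
∣p∪q∣≤∣p∣+∣q∣ Vec.[]            Vec.[]            = z≤n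
∣p∪q∣≤∣p∣+∣q∣ (outside Vec.∷ p) (outside Vec.∷ q) = ∣p∪q∣≤∣p∣+∣q∣ p q
∣p∪q∣≤∣p∣+∣q∣ (outside Vec.∷ p) (inside  Vec.∷ q) =
  ≤-trans (s≤s (∣p∪q∣≤∣p∣+∣q∣ p q)) (≤-reflexive (sym (+-suc ∣ p ∣ ∣ q ∣)))
∣p∪q∣≤∣p∣+∣q∣ (inside  Vec.∷ p) (outside Vec.∷ q) = s≤s (∣p∪q∣≤∣p∣+∣q∣ p q)
∣p∪q∣≤∣p∣+∣q∣ (inside  Vec.∷ p) (inside  Vec.∷ q) =
  s≤s (≤-trans (∣p∪q∣≤∣p∣+∣q∣ p q) (+-monoʳ-≤ ∣ p ∣ (n≤1+n ∣ q ∣)))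

∣p∪⁅x⁆∣≡1+∣p∣ : ∀ {p : Subset n} {x} → x ∉ˢ p → ∣ p ∪ ⁅ x ⁆ ∣ ≡ suc ∣ p ∣
∣p∪⁅x⁆∣≡1+∣p∣ {p = p} {x} x∉p = ≤-antisym
  (≤-trans (∣p∪q∣≤∣p∣+∣q∣ p ⁅ x ⁆)
    (≤-reflexive (trans (cong (∣ p ∣ +_) (∣⁅x⁆∣≡1 x)) (+-comm ∣ p ∣ 1))))
  (p⊂q⇒∣p∣<∣q∣ (p⊆p∪q ⁅ x ⁆ , x , q⊆p∪q p ⁅ x ⁆ (x∈⁅x⁆ x) , x∉p))

p⊆q∧∣q∣≤∣p∣⇒q⊆p : ∀ {p q : Subset n} → p ⊆ q → ∣ q ∣ ≤ ∣ p ∣ → q ⊆ p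
p⊆q∧∣q∣≤∣p∣⇒q⊆p {p = p} p⊆q ∣q∣≤∣p∣ {x} x∈q with x ∈ˢ? p
... | yes x∈p = x∈p
... | no  x∉p = contradiction (p⊂q⇒∣p∣<∣q∣ (p⊆q , x , x∈q , x∉p)) (≤⇒≯ ∣q∣≤∣p∣)

injective⇒≤∣p∣ : ∀ {m} (f : Fin m → Fin n) (p : Subset n) →
                 Injective _≡_ _≡_ f → (∀ i → f i ∈ˢ p) → m ≤ ∣ p ∣
injective⇒≤∣p∣ {m = zero}  f p inj f∈p = z≤n
injective⇒≤∣p∣ {m = suc m} f p inj f∈p = ≤-trans
  (s≤s (injective⇒≤∣p∣ (f ∘ suc) _ (suc-injective ∘ inj)
    λ i → x∈p∧x≢y⇒x∈p-y (f∈p (suc i)) λ eq → 0≢1+n (sym (inj eq))))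
  (x∈p⇒∣p-x∣<∣p∣ (f∈p zero))

range : ∀ {m} → (Fin m → Fin n) → Subset n
range f = ⋃ (tabulate λ i → ⁅ f i ⁆)

∈-range⁺ : ∀ {m} (f : Fin m → Fin n) i → f i ∈ˢ range f
∈-range⁺ f zero    = p⊆p∪q _ (x∈⁅x⁆ (f zero))
∈-range⁺ f (suc i) = q⊆p∪q ⁅ f zero ⁆ _ (∈-range⁺ (f ∘ suc) i)

∈-range⁻ : ∀ {m} (f : Fin m → Fin n) {x} → x ∈ˢ range f → ∃[ i ] x ≡ f i
∈-range⁻ {m = zero}  f x∈ = contradiction x∈ ∉⊥
∈-range⁻ {m = suc m} f x∈ with x∈p∪q⁻ ⁅ f zero ⁆ _ x∈
... | inj₁ x∈₀ = zero , x∈⁅y⁆⇒x≡y (f zero) x∈₀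
... | inj₂ x∈ₛ with i , eq ← ∈-range⁻ (f ∘ suc) x∈ₛ = suc i , eq

∣range∣≤ : ∀ {m} (f : Fin m → Fin n) → ∣ range f ∣ ≤ m
∣range∣≤ {n} {zero}  f = ≤-reflexive (∣⊥∣≡0 n)
∣range∣≤ {n} {suc m} f = ≤-trans (∣p∪q∣≤∣p∣+∣q∣ ⁅ f zero ⁆ _)
  (+-mono-≤ (≤-reflexive (∣⁅x⁆∣≡1 (f zero))) (∣range∣≤ (f ∘ suc)))

-- Assignments and literals

assignments-unique : ∀ n → Unique (assignments n)
assignments-unique zero    = [] ∷ []
assignments-unique (suc n) = Unique.++⁺
  (Unique.map⁺ Vec.∷-injectiveʳ (assignments-unique n))
  (Unique.map⁺ Vec.∷-injectiveʳ (assignments-unique n))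
  λ (∈false , ∈true) → disjoint (∈-map⁻ _ ∈false) (∈-map⁻ _ ∈true)
  where
  disjoint : ∀ {α : Assignment (suc n)} {βs γs : List (Assignment n)} →
    (∃[ β ] β ∈ βs × α ≡ false Vec.∷ β) → ¬ (∃[ γ ] γ ∈ γs × α ≡ true Vec.∷ γ)
  disjoint (_ , _ , refl) (_ , _ , ())

∈-assignments : (α : Assignment n) → α ∈ assignments n
∈-assignments Vec.[]            = here refl
∈-assignments (false Vec.∷ α) = ∈-++⁺ˡ (∈-map⁺ _ (∈-assignments α))
∈-assignments (true  Vec.∷ α) = ∈-++⁺ʳ _ (∈-map⁺ _ (∈-assignments α))

sat-unique : ∀ t (F : CNF n) → Unique (sat t F)
sat-unique t F = Unique.filter⁺ _ (assignments-unique _)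

∈-sat⁺ : ∀ {t} {F : CNF n} {α} → α ⊨ F → weight α ≡ t → α ∈ sat t F
∈-sat⁺ {t = t} {F} {α} α⊨F ∣α∣≡t =
  ∈-filter⁺ (λ α → (α ⊨? F) ×-dec (weight α ≟ t)) (∈-assignments α) (α⊨F , ∣α∣≡t)

∈-sat⁻ : ∀ {t} {F : CNF n} {α} → α ∈ sat t F → α ⊨ F × weight α ≡ t
∈-sat⁻ {n} {t} {F} α∈ = proj₂ (∈-filter⁻ (λ α → (α ⊨? F) ×-dec (weight α ≟ t)) {xs = assignments n} α∈)

∈⇒⊨pos : ∀ {α : Assignment n} {x} → x ∈ˢ α → α ⊨ˡ pos x
∈⇒⊨pos = Vec.[]=⇒lookup

⊨pos⇒∈ : ∀ {α : Assignment n} {x} → α ⊨ˡ pos x → x ∈ˢ α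
⊨pos⇒∈ = Vec.lookup⇒[]= _ _

⊆∧⊨neg⇒⊨neg : ∀ {α β : Assignment n} {x} → α ⊆ β → β ⊨ˡ neg x → α ⊨ˡ neg x
⊆∧⊨neg⇒⊨neg {α = α} {x = x} α⊆β β⊨ with Vec.lookup α x in eq
... | false = refl
... | true  with () ← trans (sym (∈⇒⊨pos (α⊆β (⊨pos⇒∈ eq)))) β⊨

-- Branching

module _ {t k : ℕ} (F : CNF n) (kcnf : IsKCNF k F) (adm : Admissible t F) where

  -- The invariant of the branching. `L` may be any duplicate-free list of such solutions, so
  -- filtering by a literal preserves it.
  record SolutionsAbove (A : Assignment n) (L : List (Assignment n)) : Set where
    field
      unique   : Unique L
      solution : ∀ {α} → α ∈ L → α ⊨ F
      above    : ∀ {α} → α ∈ L → A ⊆ α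
      weight≡t : ∀ {α} → α ∈ L → weight α ≡ t

  open SolutionsAbove

  -- Defined for negative literals too, so that sums over branches run over a whole clause and
  -- double counting applies.
  branch : Literal n → List (Assignment n) → List (Assignment n)
  branch l = filter (_⊨ˡ? l)

  ∈-branch⁻ : ∀ l L {α} → α ∈ branch l L → α ∈ L × α ⊨ˡ l
  ∈-branch⁻ l L = ∈-filter⁻ (_⊨ˡ? l) {xs = L}

  -- The equation puts the weight of `A` below `t`, so by admissibility `A` is no solution. Here
  -- `suc s` is the number of variables still to be made true.
  falsifiedClause : ∀ {A s} → weight A + suc s ≡ t →
                    ∃[ C ] C ∈ F × width C ≤ k × (∀ {l} → l ∈ C → ¬ A ⊨ˡ l)
  falsifiedClause {A} {s} ∣A∣+1+s≡t
    with find (All.¬All⇒Any¬ (A ⊨ᶜ?_) F λ A⊨F → adm (A , A⊨F , ∣A∣<t))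
    where
    ∣A∣<t : weight A < t
    ∣A∣<t = ≤-trans (s≤s (m≤m+n _ s)) (≤-reflexive (trans (sym (+-suc _ s)) ∣A∣+1+s≡t))
  ... | C , C∈F , A⊭C = C , C∈F , All.lookup kcnf C∈F , λ l∈C A⊨l → A⊭C (Any.map (λ { refl → A⊨l }) l∈C)

  branch-step : ∀ {A L x s} → weight A + suc s ≡ t → SolutionsAbove A L → x ∉ˢ A →
    weight (A ∪ ⁅ x ⁆) + s ≡ t × SolutionsAbove (A ∪ ⁅ x ⁆) (branch (pos x) L)
  branch-step {A} {L} {x} {s} ∣A∣+1+s≡t L-above x∉A =
    trans (cong (_+ s) (∣p∪⁅x⁆∣≡1+∣p∣ x∉A)) (trans (sym (+-suc _ s)) ∣A∣+1+s≡t) , record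
    { unique   = Unique.filter⁺ _ (unique L-above)
    ; solution = solution L-above ∘ proj₁ ∘ ∈-branch⁻ (pos x) L
    ; above    = λ α∈ y∈ → extend α∈ (x∈p∪q⁻ A ⁅ x ⁆ y∈)
    ; weight≡t = weight≡t L-above ∘ proj₁ ∘ ∈-branch⁻ (pos x) L
    }
    where
    extend : ∀ {α y} → α ∈ branch (pos x) L → y ∈ˢ A ⊎ y ∈ˢ ⁅ x ⁆ → y ∈ˢ α
    extend α∈ (inj₁ y∈A) = above L-above (proj₁ (∈-branch⁻ (pos x) L α∈)) y∈A
    extend α∈ (inj₂ y∈x) with refl ← x∈⁅y⁆⇒x≡y x y∈x = ⊨pos⇒∈ (proj₂ (∈-branch⁻ (pos x) L α∈))

  -- The variable of a negative literal false in `A` is true in `A`, hence in every solution above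
  -- `A`. Only positive literals on variables outside `A` can lead anywhere.
  falsified-literal : ∀ {A L} → SolutionsAbove A L → ∀ l → ¬ A ⊨ˡ l →
    branch l L ≡ [] ⊎ (∃[ x ] l ≡ pos x × x ∉ˢ A)
  falsified-literal L-above (pos x) A⊭l = inj₂ (x , refl , A⊭l ∘ ∈⇒⊨pos)
  falsified-literal L-above (neg x) A⊭l = inj₁ (filter-none (_⊨ˡ? neg x)
    (All.tabulate λ α∈L α⊨l → A⊭l (⊆∧⊨neg⇒⊨neg (above L-above α∈L) α⊨l)))

  hits : Clause n → Assignment n → ℕ
  hits C α = length (filter (α ⊨ˡ?_) C)

  module _ {C A L} (C∈F : C ∈ F) (L-above : SolutionsAbove A L) where

    1≤hits : ∀ {α} → α ∈ L → 1 ≤ hits C α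
    1≤hits {α} α∈L = filter-some (α ⊨ˡ?_) (All.lookup (solution L-above α∈L) C∈F)

    sum-branches≡sum-hits : sum (map (λ l → length (branch l L)) C) ≡ sum (map (hits C) L)
    sum-branches≡sum-hits = double-counting (λ l α → α ⊨ˡ l) (λ l → _⊨ˡ? l) C L

    -- Each solution satisfies `C`, so it lies in at least one branch.
    length≤sum-branches : length L ≤ sum (map (λ l → length (branch l L)) C)
    length≤sum-branches = begin
      length L              ≡⟨ *-identityʳ (length L) ⟨
      length L * 1          ≤⟨ length*b≤sum (hits C) 1 L 1≤hits ⟩
      sum (map (hits C) L)  ≡⟨ sum-branches≡sum-hits ⟨
      sum (map (λ l → length (branch l L)) C) ∎
      where open ≤-Reasoning

  mutual

    solutions≤k^s : ∀ s {A L} → weight A + s ≡ t → SolutionsAbove A L → length L ≤ k ^ s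
    -- Now `A` already has weight `t`, so a solution of weight `t` above it can only be `A` itself.
    solutions≤k^s zero {A} {L} ∣A∣+0≡t L-above = unique∧constant⇒length≤1 (unique L-above) λ α∈L →
      ⊆-antisym (p⊆q∧∣q∣≤∣p∣⇒q⊆p (above L-above α∈L)
        (≤-reflexive (trans (weight≡t L-above α∈L) (trans (sym ∣A∣+0≡t) (+-identityʳ _)))))
        (above L-above α∈L)
    solutions≤k^s (suc s) {A} {L} wt L-above
      with C , C∈F , ∣C∣≤k , A⊭C ← falsifiedClause wt = begin
        length L                                 ≤⟨ length≤sum-branches C∈F L-above ⟩
        sum (map (λ l → length (branch l L)) C)  ≤⟨ sum≤length*b _ _ C (λ l∈C → branch≤k^s s wt L-above (A⊭C l∈C)) ⟩
        length C * k ^ s                         ≤⟨ *-monoˡ-≤ (k ^ s) ∣C∣≤k ⟩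
        k * k ^ s                                ∎
      where open ≤-Reasoning

    branch≤k^s : ∀ s {A L l} → weight A + suc s ≡ t → SolutionsAbove A L → ¬ A ⊨ˡ l →
                 length (branch l L) ≤ k ^ s
    branch≤k^s s {l = l} wt L-above A⊭l with falsified-literal L-above l A⊭l
    ... | inj₁ empty rewrite empty = z≤n
    ... | inj₂ (x , refl , x∉A) with wt′ , above′ ← branch-step wt L-above x∉A =
      solutions≤k^s s wt′ above′

  -- `fresh` and `hit` strengthen the induction: they let an earlier branching clause be shown
  -- disjoint from all clauses found further down its branch.
  record DisjointClauses (s : ℕ) (A : Assignment n) (L : List (Assignment n)) : Set where
    field
      clause   : Fin s → Clause n
      clause∈F : ∀ a → clause a ∈ F
      positive : ∀ a → IsPositiveClause k (clause a)
      disjoint : ∀ a b → a ≢ b → VariableDisjoint (clause a) (clause b)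
      fresh    : ∀ a {x} → x ∈ vars (clause a) → x ∉ˢ A
      hit      : ∀ a {x} → x ∈ vars (clause a) → ∃[ α ] α ∈ L × α ⊨ˡ pos x

  open DisjointClauses

  -- When the bound is attained, the chain from `length L` through the sum of `hits`, which is the
  -- sum of the branch sizes, and `width C * k ^ s` up to `k * k ^ s` collapses to equalities.
  -- Positivity of `k` allows cancelling `k ^ s` and makes the branches nonempty.
  module TightStep .{{_ : NonZero k}} (s : ℕ) {A L C}
    (wt : weight A + suc s ≡ t) (L-above : SolutionsAbove A L) (tight : length L ≡ k ^ suc s)
    (C∈F : C ∈ F) (∣C∣≤k : width C ≤ k) (A⊭C : ∀ {l} → l ∈ C → ¬ A ⊨ˡ l)
    where

    private instance
      k^s≢0 : NonZero (k ^ s)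
      k^s≢0 = m^n≢0 k s

    k*k^s≤sum-branches : k * k ^ s ≤ sum (map (λ l → length (branch l L)) C)
    k*k^s≤sum-branches = subst (_≤ sum (map (λ l → length (branch l L)) C)) tight (length≤sum-branches C∈F L-above)

    sum-branches≤ : sum (map (λ l → length (branch l L)) C) ≤ width C * k ^ s
    sum-branches≤ = sum≤length*b _ _ C λ l∈C → branch≤k^s s wt L-above (A⊭C l∈C)

    ∣C∣≡k : width C ≡ k
    ∣C∣≡k = ≤-antisym ∣C∣≤k (*-cancelʳ-≤ k (width C) (k ^ s) (≤-trans k*k^s≤sum-branches sum-branches≤))

    ∣branch∣≡k^s : ∀ {l} → l ∈ C → length (branch l L) ≡ k ^ s
    ∣branch∣≡k^s = sum-tight-≤ _ (k ^ s) C (λ l∈C → branch≤k^s s wt L-above (A⊭C l∈C))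
      (≤-trans (*-monoˡ-≤ (k ^ s) ∣C∣≤k) k*k^s≤sum-branches)

    branch-inhabited : ∀ {l} → l ∈ C → ∃[ α ] α ∈ branch l L
    branch-inhabited l∈C = length>0⇒∃∈ _ (subst (0 <_) (sym (∣branch∣≡k^s l∈C)) (>-nonZero⁻¹ (k ^ s)))

    -- Every solution has at least one hit, while the total number of hits is at most `length L`, so
    -- no solution can have a second.
    hits≤1 : ∀ {α} → α ∈ L → hits C α ≤ 1
    hits≤1 α∈L = ≤-reflexive (sum-tight-≥ (hits C) 1 L (1≤hits C∈F L-above) (begin
      sum (map (hits C) L)                     ≡⟨ sum-branches≡sum-hits C∈F L-above ⟨
      sum (map (λ l → length (branch l L)) C)  ≤⟨ sum-branches≤ ⟩
      width C * k ^ s                          ≤⟨ *-monoˡ-≤ (k ^ s) ∣C∣≤k ⟩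
      k * k ^ s                                ≡⟨ tight ⟨
      length L                                 ≡⟨ *-identityʳ (length L) ⟨
      length L * 1                             ∎) α∈L)
      where open ≤-Reasoning

    one-hit : ∀ {α} → α ∈ L → ∀ i j → α ⊨ˡ lookup C i → α ⊨ˡ lookup C j → i ≡ j
    one-hit {α} α∈L = filter≤1⇒lookup-injective (α ⊨ˡ?_) C (hits≤1 α∈L)

    -- A negative literal would have an empty branch, but in the tight case every branch has `k ^ s`
    -- solutions.
    literal-pos : ∀ {l} → l ∈ C → l ≡ pos (var l) × var l ∉ˢ A
    literal-pos {l} l∈C with falsified-literal L-above l (A⊭C l∈C)
    ... | inj₂ (x , refl , x∉A) = refl , x∉A
    ... | inj₁ empty with α , α∈ ← branch-inhabited l∈C = contradiction (subst (α ∈_) empty α∈) λ ()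

    variables : Fin (width C) → Fin n
    variables = var ∘ lookup C

    lookup≡pos : ∀ i → lookup C i ≡ pos (variables i)
    lookup≡pos i = proj₁ (literal-pos (∈-lookup i))

    -- A solution in the branch of the literal at `i` would also satisfy an equal literal at `j`,
    -- giving two hits.
    variables-injective : Injective _≡_ _≡_ variables
    variables-injective {i} {j} eq with α , α∈ ← branch-inhabited (∈-lookup {xs = C} i)
      with α∈L , α⊨i ← ∈-branch⁻ (lookup C i) L α∈ =
      one-hit α∈L i j α⊨i (subst (α ⊨ˡ_) (trans (lookup≡pos i) (trans (cong pos eq) (sym (lookup≡pos j)))) α⊨i)

    C-positive : IsPositiveClause k C
    C-positive = subst (λ m → IsPositiveClause m C) ∣C∣≡k
      (variables , variables-injective , trans (sym (tabulate-lookup C)) (tabulate-cong lookup≡pos))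

    ∈vars⇒pos∈ : ∀ {x} → x ∈ vars C → pos x ∈ C
    ∈vars⇒pos∈ x∈C with l , l∈C , refl ← ∈-map⁻ var x∈C = subst (_∈ C) (proj₁ (literal-pos l∈C)) l∈C

    C-fresh : ∀ {x} → x ∈ vars C → x ∉ˢ A
    C-fresh x∈C = proj₂ (literal-pos (∈vars⇒pos∈ x∈C))

    C-hit : ∀ {x} → x ∈ vars C → ∃[ α ] α ∈ L × α ⊨ˡ pos x
    C-hit {x} x∈C with α , α∈ ← branch-inhabited (∈vars⇒pos∈ x∈C) = α , ∈-branch⁻ (pos x) L α∈

    -- The clauses found in the one branch at `x` suffice; `C` is put in front of them.
    extend : ∀ {x} → pos x ∈ C → DisjointClauses s (A ∪ ⁅ x ⁆) (branch (pos x) L) →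
             DisjointClauses (suc s) A L
    extend {x} x∈C D = record
      { clause   = λ { zero → C          ; (suc a) → clause D a }
      ; clause∈F = λ { zero → C∈F        ; (suc a) → clause∈F D a }
      ; positive = λ { zero → C-positive ; (suc a) → positive D a }
      ; disjoint = λ where
          zero    zero    0≢0 → contradiction refl 0≢0
          zero    (suc b) _   → λ (y∈C , y∈b) → C-disjoint b y∈C y∈b
          (suc a) zero    _   → λ (y∈a , y∈C) → C-disjoint a y∈C y∈a
          (suc a) (suc b) a≢b → disjoint D a b (a≢b ∘ cong suc)
      ; fresh    = λ where
          zero    → C-fresh
          (suc a) → λ y∈a → fresh D a y∈a ∘ p⊆p∪q ⁅ x ⁆
      ; hit      = λ where
          zero    → C-hit
          (suc a) y∈a → let α , α∈ , α⊨y = hit D a y∈a in α , proj₁ (∈-branch⁻ (pos x) L α∈) , α⊨y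
      }
      where
      -- For a shared variable `y`, `hit` gives a solution in the branch of `x` that makes `y` true.
      -- It satisfies both `pos x` and `pos y` in `C`, so `x` is `y`; but `fresh` keeps `y` out of
      -- the set to which `x` was added.
      C-disjoint : ∀ a {y} → y ∈ vars C → ¬ (y ∈ vars (clause D a))
      C-disjoint a {y} y∈C y∈a
        with α , α∈ , α⊨y ← hit D a y∈a
        with α∈L , α⊨x ← ∈-branch⁻ (pos x) L α∈
        = fresh D a y∈a (subst (_∈ˢ A ∪ ⁅ x ⁆) x≡y (q⊆p∪q A ⁅ x ⁆ (x∈⁅x⁆ x)))
        where
        p∈C : pos y ∈ C
        p∈C = ∈vars⇒pos∈ y∈C
        same : Any.index x∈C ≡ Any.index p∈C
        same = one-hit α∈L _ _ (subst (α ⊨ˡ_) (Any.lookup-index x∈C) α⊨x)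
                               (subst (α ⊨ˡ_) (Any.lookup-index p∈C) α⊨y)
        x≡y : x ≡ y
        x≡y = cong var (trans (Any.lookup-index x∈C) (trans (cong (lookup C) same) (sym (Any.lookup-index p∈C))))

  disjointClauses : .{{_ : NonZero k}} → ∀ s {A L} → weight A + s ≡ t → SolutionsAbove A L →
                    length L ≡ k ^ s → DisjointClauses s A L
  disjointClauses zero wt L-above tight = record
    { clause = λ () ; clause∈F = λ () ; positive = λ () ; disjoint = λ () ; fresh = λ () ; hit = λ () }
  disjointClauses (suc s) {A} {L} wt L-above tight
    with C , C∈F , ∣C∣≤k , A⊭C ← falsifiedClause wt
    -- Any literal of `C` will do, since all branches are tight; one exists because `C` has width
    -- `k`, which is positive.
    with l , l∈C ← length>0⇒∃∈ C (subst (0 <_) (sym (TightStep.∣C∣≡k s wt L-above tight C∈F ∣C∣≤k A⊭C)) (>-nonZero⁻¹ k))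
    = extend posl∈C (disjointClauses s (proj₁ step) (proj₂ step) (∣branch∣≡k^s posl∈C))
    where
    open TightStep s wt L-above tight C∈F ∣C∣≤k A⊭C
    posl∈C : pos (var l) ∈ C
    posl∈C = subst (_∈ C) (proj₁ (literal-pos l∈C)) l∈C
    step = branch-step wt L-above (proj₂ (literal-pos l∈C))

  weight-⊥+t : weight (⊥ {n}) + t ≡ t
  weight-⊥+t = cong (_+ t) (∣⊥∣≡0 n)

  -- The branching starts at the empty set, with all `t` variables still to be chosen.
  sat-above-⊥ : SolutionsAbove ⊥ (sat t F)
  sat-above-⊥ = record
    { unique   = sat-unique t F
    ; solution = proj₁ ∘ ∈-sat⁻
    ; above    = λ _ → ⊥⊆
    ; weight≡t = proj₂ ∘ ∈-sat⁻ {F = F}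
    }

  ∣sat∣≤k^t : ∣sat∣ t F ≤ k ^ t
  ∣sat∣≤k^t = solutions≤k^s t weight-⊥+t sat-above-⊥

  tight⇒disjointClauses : .{{_ : NonZero k}} → ∣sat∣ t F ≡ k ^ t → DisjointClauses t ⊥ (sat t F)
  tight⇒disjointClauses = disjointClauses t weight-⊥+t sat-above-⊥

-- The extremal formula

module Extremal (k t n : ℕ) (kt≤n : k * t ≤ n) where

  tk≤n : t * k ≤ n
  tk≤n = ≤-trans (≤-reflexive (*-comm t k)) kt≤n

  -- Variable `j` of block `a`: the first `t * k` variables are cut into `t` disjoint blocks of size
  -- `k`.
  x[_,_] : Fin t → Fin k → Fin n
  x[ a , j ] = inject≤ (combine a j) tk≤n

  x-injective : ∀ {a b i j} → x[ a , i ] ≡ x[ b , j ] → a ≡ b × i ≡ j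
  x-injective eq = combine-injective _ _ _ _ (inject≤-injective tk≤n tk≤n _ _ eq)

  block : Fin t → Clause n
  block a = tabulate λ j → pos x[ a , j ]

  formula : CNF n
  formula = tabulate block

  formula-kCNF : IsKCNF k formula
  formula-kCNF = All.tabulate⁺ λ a → ≤-reflexive (length-tabulate λ j → pos x[ a , j ])

  hitting : ∀ {α} → α ⊨ formula → ∀ a → ∃[ j ] x[ a , j ] ∈ˢ α
  hitting α⊨ a with j , α⊨j ← Any.tabulate⁻ (All.tabulate⁻ α⊨ a) = j , ⊨pos⇒∈ α⊨j

  -- A solution contains a variable from each block, and these are distinct because the blocks are
  -- disjoint.
  t≤weight : ∀ {α} → α ⊨ formula → t ≤ weight α
  t≤weight α⊨ = injective⇒≤∣p∣ (λ a → x[ a , proj₁ (hitting α⊨ a) ]) _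
    (proj₁ ∘ x-injective) (proj₂ ∘ hitting α⊨)

  formula-admissible : Admissible t formula
  formula-admissible (α , α⊨ , ∣α∣<t) = <⇒≱ ∣α∣<t (t≤weight α⊨)

  -- One variable is chosen from each block; the choices account for the `k ^ t` solutions.
  transversal : (Fin t → Fin k) → Assignment n
  transversal c = range λ a → x[ a , c a ]

  transversal⊨ : ∀ c → transversal c ⊨ formula
  transversal⊨ c = All.tabulate⁺ λ a → Any.tabulate⁺ (c a) (∈⇒⊨pos (∈-range⁺ _ a))

  transversal∈sat : ∀ c → transversal c ∈ sat t formula
  transversal∈sat c = ∈-sat⁺ (transversal⊨ c) (≤-antisym (∣range∣≤ _) (t≤weight (transversal⊨ c)))

  -- The variable that `c` picks in block `a` is also picked by `d` in some block, which must be
  -- `a`. Agreement is stated pointwise to avoid function extensionality.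
  transversal-injective : ∀ c d → transversal c ≡ transversal d → ∀ a → c a ≡ d a
  transversal-injective c d eq a
    with b , x≡ ← ∈-range⁻ (λ a → x[ a , d a ]) (subst (x[ a , c a ] ∈ˢ_) eq (∈-range⁺ (λ a → x[ a , c a ]) a))
    with refl , ca≡da ← x-injective {a} {b} {c a} {d b} x≡ = ca≡da

  funToFin-cong : ∀ {m} {c d : Fin m → Fin k} → (∀ a → c a ≡ d a) → funToFin c ≡ funToFin d
  funToFin-cong {zero}  c≗d = refl
  funToFin-cong {suc m} c≗d = cong₂ combine (c≗d zero) (funToFin-cong (c≗d ∘ suc))

  k^t≤∣sat∣ : k ^ t ≤ ∣sat∣ t formula
  -- `finToFun` enumerates the choice functions by the numbers below `k ^ t`.
  k^t≤∣sat∣ = injective⇒≤length {f = transversal ∘ finToFun} inj (transversal∈sat ∘ finToFun)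
    where
    inj : Injective _≡_ _≡_ (transversal ∘ finToFun)
    inj {i} {j} eq = trans (sym (funToFin-finToFin {t} {k} i))
      (trans (funToFin-cong (transversal-injective _ _ eq)) (funToFin-finToFin {t} {k} j))

theorem1 : ∀ (k t n : ℕ) → k ≥ 1 → n ≥ k * t →
    (S[ n , t , k ]≡ (k ^ t)) ×
    (∀ (F : CNF n) → IsKCNF k F → Admissible t F → ∣sat∣ t F ≡ k ^ t →
    Σ[ C ∈ (Fin t → Clause n) ]
    (∀ a → C a ∈ F) ×
    (∀ a → IsPositiveClause k (C a)) ×
    (∀ a b → a ≢ b → VariableDisjoint (C a) (C b)))
theorem1 k t n k≥1 n≥kt =
  ( ( formula , formula-kCNF , formula-admissible
    , ≤-antisym (∣sat∣≤k^t formula formula-kCNF formula-admissible) k^t≤∣sat∣ )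
  , λ { _ (F , kcnf , adm , refl) → ∣sat∣≤k^t F kcnf adm } )
  , λ F kcnf adm tight →
      let open DisjointClauses (tight⇒disjointClauses F kcnf adm {{>-nonZero k≥1}} tight)
      in clause , clause∈F , positive , disjoint
  where open Extremal k t n n≥kt
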